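{- Let $t$ be a positive integer and let $K_n$ be a complete graph on $n$ vertices. Then $$c\chi_2^t(K_n)=\begin{cases}\frac{3n}{2},&\text{if } t=1 \text{ and } n\text{ is even},\\[1mm] \frac{3n+1}{2},&\text{if } t=1\text{ and } n\text{ is odd},\\[1mm] n,&\text{if } t\ge 2.\end{cases}$$
   Context: Graphs are undirected and simple. For a positive integer $k$ and $i,j\in\{0,1,\dots,k-1\}$, the circular distance is $|i-j|_k=\min\{|i-j|,\,k-|i-j|\}$. For a nonnegative integer $t$, a $(\frac{k}{2},t)^*$-coloring of a graph $G$ is a mapping $f:V(G)\to\{0,1,\dots,k-1\}$ such that adjacent vertices receive different integers and, for each vertex $u$, the number of neighbors $v$ of $u$ with $|f(u)-f(v)|_k=1$ is at most $t$. $G$ is $(\frac{k}{2},t)^*$-colorable if it has such a coloring. (The symbol $\frac{k}{2}$ is formal notation recording the pair $(k,2)$, not a reduced fraction.) The $t$-relaxed 2-distant circular chromatic number $c\chi_2^t(G)$ is the minimum integer $k$ such that $G$ is $(\frac{k}{2},t)^*$-colorable.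
   Formalization: For t = 1 the formulas are stated only for n ≥ 3, since they fail for n = 1 (the value is 1, not 2) and for n = 2 (the value is 2, not 3, by the colors 0, 1 with k = 2); the case t ≥ 2 is stated for all n ≥ 1. -}

module Defs where

open import Data.Nat.Base using (ℕ; _≤_; _≥_; _∸_; _⊓_; ∣_-_∣)
import Data.Nat.Properties as ℕ
open import Data.Fin.Base using (Fin; toℕ)
import Data.Fin.Properties as Fin
open import Data.List.Base using (length; filter; allFin)
open import Data.Product.Base using (_×_; ∃-syntax)
open import Level using (0ℓ)
open import Relation.Binary.Core using (Rel)
open import Relation.Binary.Definitions using (Decidable; Symmetric)
open import Relation.Binary.PropositionalEquality
  using (_≡_; _≢_; refl; ≢-sym)
open import Relation.Nullary.Negation using (¬_)
open import Relation.Nullary.Decidable using (_×-dec_; ¬?)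

record Graph : Set₁ where
  field
    order   : ℕ
    Adj     : Rel (Fin order) 0ℓ
    adj?    : Decidable Adj
    adj-sym : Symmetric Adj
    no-loop : ∀ u → ¬ Adj u u

  Vertex : Set
  Vertex = Fin order

open Graph

K : ℕ → Graph
K n .order          = n
K n .Adj            = _≢_
K n .adj?     u v   = ¬? (u Fin.≟ v)
K n .adj-sym        = ≢-sym
K n .no-loop  u u≢u = u≢u refl

-- The truncated subtraction is exact, since ∣ i - j ∣ < k for i , j < k.
circDist : ∀ {k} → Fin k → Fin k → ℕ
circDist {k} i j = ∣ toℕ i - toℕ j ∣ ⊓ (k ∸ ∣ toℕ i - toℕ j ∣)

-- The number of neighbours v of u with |f(u) - f(v)|ₖ = 1.
defect : ∀ (G : Graph) {k} → (Vertex G → Fin k) → Vertex G → ℕ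
defect G f u =
  length (filter (λ v → adj? G u v ×-dec (circDist (f u) (f v) ℕ.≟ 1))
                 (allFin (order G)))

-- IsColoring k t G f : f is a (k/2, t)*-coloring of G.  The fraction is
-- formal, so only k appears.
IsColoring : (k t : ℕ) (G : Graph) → (Vertex G → Fin k) → Set
IsColoring k t G f =
  (∀ u v → Adj G u v → f u ≢ f v) × (∀ u → defect G f u ≤ t)

Colorable : (k t : ℕ) → Graph → Set
Colorable k t G = ∃[ f ] IsColoring k t G f

-- IsCχ₂ t G m : the t-relaxed 2-distant circular chromatic number of G is m,
-- i.e. m is the least positive integer k for which G is (k/2, t)*-colorable.
IsCχ₂ : (t : ℕ) → Graph → ℕ → Set
IsCχ₂ t G m =
  m ≥ 1 × Colorable m t G × (∀ k → k ≥ 1 → Colorable k t G → m ≤ k)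

{-# OPTIONS --safe #-}

-- Suppose t = 1 and f is a coloring with k ≥ 3 colors. It is injective, and of
-- the two cyclic neighbours of a used color at least one is unused. Taking two
-- copies of every color, each vertex u can therefore be given three of them for
-- itself alone: both copies of f u, and either copy 0 of the unused successor
-- or copy 1 of the unused predecessor. Hence 3n ≤ 2k. The bound is attained by
-- the colors 0, 1, 3, 4, 6, 7, …, which come in isolated pairs. For t ≥ 2 the
-- identity coloring is optimal, as a color has only two cyclic neighbours.
module Submission where

open import Defs
open import Data.Nat.Base using (ℕ; _≥_; _+_; _*_; _/_)
open import Data.Nat.Divisibility using (_∣_; _∤_)
open import Data.Product.Base using (_×_)
open import Relation.Binary.PropositionalEquality using (_≡_)
open import Data.Nat.Base using (zero; suc; _≤_; _<_; z≤n; s≤s; z<s; _∸_; _⊓_; _%_; ∣_-_∣)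
import Data.Nat.Properties as ℕ
open import Data.Nat.Divisibility using (divides-refl)
open import Data.Nat.DivMod using (m≡m%n+[m/n]*n; m%n<n; m*n/n≡m)
open import Data.Nat.Tactic.RingSolver using (solve-∀)
open import Data.Fin.Base using (Fin; zero; suc; toℕ; fromℕ; fromℕ<; inject₁; combine; remQuot)
import Data.Fin.Properties as Fin
open import Data.Fin.Relation.Unary.Top using (view; ‵fromℕ; ‵inject₁; view-fromℕ; view-inject₁)
open import Data.List.Base using (List; _∷_; length; lookup; filter; allFin)
open import Data.List.Membership.Propositional using (_∈_)
open import Data.List.Membership.Propositional.Properties using (∈-filter⁺; ∈-allFin; ∈-lookup)
import Data.List.Relation.Unary.All as All
open import Data.List.Relation.Unary.All.Properties using (all-filter)
open import Data.List.Relation.Unary.Any using (here; there)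
open import Data.List.Relation.Unary.AllPairs using (_∷_)
open import Data.List.Relation.Unary.Unique.Propositional using (Unique)
open import Data.List.Relation.Unary.Unique.Propositional.Properties using (filter⁺; allFin⁺)
open import Data.Product.Base using (_,_; proj₁; proj₂; uncurry; ∃-syntax)
open import Data.Product.Properties using (,-injective)
open import Data.Sum.Base as Sum using (_⊎_; inj₁; inj₂; [_,_]′)
open import Level using (0ℓ)
open import Function.Base using (_∘_; id)
open import Function.Definitions using (Injective)
open import Relation.Binary.PropositionalEquality
  using (_≢_; refl; sym; trans; cong; cong₂; subst; module ≡-Reasoning)
open import Relation.Nullary.Decidable using (yes; no; _×-dec_; decidable-stable)
open import Relation.Nullary.Negation using (contradiction)
open import Relation.Unary using (Pred; Decidable)

-- Differences of naturals, and counting in filtered lists.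

∣m-n∣≡1⇒consecutive : ∀ m n → ∣ m - n ∣ ≡ 1 → n ≡ suc m ⊎ m ≡ suc n
∣m-n∣≡1⇒consecutive zero    n       eq = inj₁ eq
∣m-n∣≡1⇒consecutive (suc m) zero    eq = inj₂ eq
∣m-n∣≡1⇒consecutive (suc m) (suc n) eq = Sum.map (cong suc) (cong suc) (∣m-n∣≡1⇒consecutive m n eq)

-- If both numbers were positive, the difference of their predecessors would be at most the larger
-- predecessor, which is below `o`.
∣m-n∣≡o⇒extremal : ∀ {m n o} → m ≤ o → n ≤ o → ∣ m - n ∣ ≡ o →
                   (m ≡ 0 × n ≡ o) ⊎ (m ≡ o × n ≡ 0)
∣m-n∣≡o⇒extremal {zero}          _   _   eq = inj₁ (refl , eq)
∣m-n∣≡o⇒extremal {suc m} {zero}  _   _   eq = inj₂ (eq , refl)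
∣m-n∣≡o⇒extremal {suc m} {suc n} m<o n<o eq =
  contradiction eq (ℕ.<⇒≢ (ℕ.≤-<-trans (ℕ.∣m-n∣≤m⊔n m n) (ℕ.⊔-lub m<o n<o)))

odd-form : ∀ n → 2 ∤ n → ∃[ p ] n ≡ 1 + p * 2
odd-form n 2∤n with n % 2 | m%n<n n 2 | m≡m%n+[m/n]*n n 2
... | 0           | _              | eq = contradiction (subst (2 ∣_) (sym eq) (divides-refl (n / 2))) 2∤n
... | 1           | _              | eq = n / 2 , eq
... | suc (suc _) | s≤s (s≤s ())   | _

lookup-injective : ∀ {A : Set} {xs : List A} → Unique xs → Injective _≡_ _≡_ (lookup xs)
lookup-injective (_ ∷ _)   {zero}  {zero}  _  = refl
lookup-injective (px ∷ _)  {zero}  {suc j} eq = contradiction eq (All.lookup px (∈-lookup j))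
lookup-injective (px ∷ _)  {suc i} {zero}  eq = contradiction (sym eq) (All.lookup px (∈-lookup i))
lookup-injective (_ ∷ uxs) {suc i} {suc j} eq = cong suc (lookup-injective uxs eq)

module _ {n} {P : Pred (Fin n) 0ℓ} (P? : Decidable P) where

  -- Pigeonhole: the list has no repetitions, so its positions inject into `Fin t`. As `g` acts on
  -- proofs, it may depend on how `P v` holds.
  count-≤ : ∀ {t} (g : ∀ {v} → P v → Fin t) →
            (∀ {v w} (p : P v) (q : P w) → g p ≡ g q → v ≡ w) →
            length (filter P? (allFin n)) ≤ t
  count-≤ g g-inj = Fin.injective⇒≤ {f = λ i → g (P-lookup i)}
    (lookup-injective (filter⁺ P? (allFin⁺ n)) ∘ g-inj _ _)
    where
    P-lookup : ∀ i → P (lookup (filter P? (allFin n)) i)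
    P-lookup i = All.lookup (all-filter P? (allFin n)) (∈-lookup i)

  count-≥2 : ∀ {v w} → v ≢ w → P v → P w → 2 ≤ length (filter P? (allFin n))
  count-≥2 v≢w p q = two-members v≢w (∈-filter⁺ P? (∈-allFin _) p) (∈-filter⁺ P? (∈-allFin _) q)
    where
    two-members : ∀ {v w} {xs : List (Fin n)} → v ≢ w → v ∈ xs → w ∈ xs → 2 ≤ length xs
    two-members v≢w (here refl) (here refl)            = contradiction refl v≢w
    two-members _   (here _)    (there {xs = _ ∷ _} _) = s≤s (s≤s z≤n)
    two-members _   (there {xs = _ ∷ _} _) _           = s≤s (s≤s z≤n)

-- The cyclic successor and predecessor of a color.

next : ∀ {m} → Fin (suc m) → Fin (suc m)
next i with view i
... | ‵fromℕ     = zero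
... | ‵inject₁ j = suc j

prev : ∀ {m} → Fin (suc m) → Fin (suc m)
prev zero    = fromℕ _
prev (suc j) = inject₁ j

prev-next : ∀ {m} (i : Fin (suc m)) → prev (next i) ≡ i
prev-next i with view i
... | ‵fromℕ     = refl
... | ‵inject₁ j = refl

next-prev : ∀ {m} (i : Fin (suc m)) → next (prev i) ≡ i
next-prev {m} zero    rewrite view-fromℕ m   = refl
next-prev     (suc j) rewrite view-inject₁ j = refl

next-injective : ∀ {m} → Injective _≡_ _≡_ (next {m})
next-injective {_} {i} {j} eq = trans (sym (prev-next i)) (trans (cong prev eq) (prev-next j))

prev-injective : ∀ {m} → Injective _≡_ _≡_ (prev {m})
prev-injective {_} {i} {j} eq = trans (sym (next-prev i)) (trans (cong next eq) (next-prev j))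

toℕ-next : ∀ {m} (i : Fin (suc m)) →
           (toℕ i ≡ m × toℕ (next i) ≡ 0) ⊎ toℕ (next i) ≡ suc (toℕ i)
toℕ-next {m} i with view i
... | ‵fromℕ     = inj₁ (Fin.toℕ-fromℕ m , refl)
... | ‵inject₁ j = inj₂ (cong suc (sym (Fin.toℕ-inject₁ j)))

next-of-last : ∀ {m} (i j : Fin (suc m)) → toℕ i ≡ m → toℕ j ≡ 0 → j ≡ next i
next-of-last i j i≡m j≡0 with toℕ-next i
... | inj₁ (_ , eq) = Fin.toℕ-injective (trans j≡0 (sym eq))
... | inj₂ eq       = contradiction (trans eq (cong suc i≡m)) (ℕ.<⇒≢ (Fin.toℕ<n (next i)))

next-of-suc : ∀ {m} (i j : Fin (suc m)) → toℕ j ≡ suc (toℕ i) → j ≡ next i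
next-of-suc i j j≡1+i with toℕ-next i
... | inj₁ (i≡m , _) = contradiction (trans j≡1+i (cong suc i≡m)) (ℕ.<⇒≢ (Fin.toℕ<n j))
... | inj₂ eq        = Fin.toℕ-injective (trans j≡1+i (sym eq))

-- With no wrap-around, two steps raise the value by 2; a single wrap-around forces `m` to be 1, and
-- two force it to be 0.
next²≢id : ∀ {m} → 2 ≤ m → (i : Fin (suc m)) → next (next i) ≢ i
next²≢id {m} 2≤m i eq with toℕ-next i | toℕ-next (next i)
... | inj₂ a         | inj₂ b         = ℕ.m≢1+n+m (toℕ i) (trans (cong toℕ (sym eq)) (trans b (cong suc a)))
... | inj₂ a         | inj₁ (b , c)   =
  ℕ.<⇒≢ 2≤m (trans (cong suc (trans (sym c) (cong toℕ eq))) (trans (sym a) b))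
... | inj₁ (a , b)   | inj₂ c         =
  ℕ.<⇒≢ 2≤m (trans (cong suc (sym b)) (trans (sym c) (trans (cong toℕ eq) a)))
... | inj₁ (_ , a)   | inj₁ (b , _)   = ℕ.<⇒≢ (ℕ.<-trans z<s 2≤m) (trans (sym a) b)

next≢prev : ∀ {m} → 2 ≤ m → (i : Fin (suc m)) → next i ≢ prev i
next≢prev 2≤m i eq = next²≢id 2≤m i (trans (cong next eq) (next-prev i))

-- Circular distance 1.

circDist-sym : ∀ {k} (i j : Fin k) → circDist i j ≡ circDist j i
circDist-sym {k} i j = cong (λ d → d ⊓ (k ∸ d)) (ℕ.∣-∣-comm (toℕ i) (toℕ j))

circDist-self : ∀ {k} (i : Fin k) → circDist i i ≡ 0
circDist-self i rewrite ℕ.∣n-n∣≡0 (toℕ i) = refl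

circDist-next : ∀ {m} → 1 ≤ m → (i : Fin (suc m)) → circDist i (next i) ≡ 1
circDist-next {m} 1≤m i with toℕ-next i
... | inj₁ (a , b) rewrite a | b | ℕ.∣-∣-identityʳ m | ℕ.m+n∸n≡m 1 m = ℕ.m≥n⇒m⊓n≡n 1≤m
... | inj₂ a rewrite a | ℕ.+-comm 1 (toℕ i) | ℕ.∣m-m+n∣≡n (toℕ i) 1 = ℕ.m≤n⇒m⊓n≡m 1≤m

circDist-prev : ∀ {m} → 1 ≤ m → (i : Fin (suc m)) → circDist i (prev i) ≡ 1
circDist-prev 1≤m i = begin
  circDist i (prev i)               ≡⟨ circDist-sym i (prev i) ⟩
  circDist (prev i) i               ≡⟨ cong (circDist (prev i)) (next-prev i) ⟨
  circDist (prev i) (next (prev i)) ≡⟨ circDist-next 1≤m (prev i) ⟩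
  1                                 ∎
  where open ≡-Reasoning

-- Neither color is the last one, so the difference is at most `k ∸ 2` and the way around the end
-- has length at least 2.
circDist≡1⇒∣-∣≡1 : ∀ {k} (i j : Fin k) → 2 + toℕ i ≤ k → 2 + toℕ j ≤ k →
                   circDist i j ≡ 1 → ∣ toℕ i - toℕ j ∣ ≡ 1
circDist≡1⇒∣-∣≡1 {k} i j i≤ j≤ eq with ℕ.⊓-sel ∣ toℕ i - toℕ j ∣ (k ∸ ∣ toℕ i - toℕ j ∣)
... | inj₁ ⊓≡ˡ = trans (sym ⊓≡ˡ) eq
... | inj₂ ⊓≡ʳ = contradiction (trans (sym eq) ⊓≡ʳ) (ℕ.<⇒≢ (ℕ.m+n≤o⇒m≤o∸n 2 2+d≤k))
  where
  2+d≤k : 2 + ∣ toℕ i - toℕ j ∣ ≤ k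
  2+d≤k = ℕ.≤-trans (ℕ.+-monoʳ-≤ 2 (ℕ.∣m-n∣≤m⊔n (toℕ i) (toℕ j))) (ℕ.⊔-lub i≤ j≤)

-- Either the difference itself is 1, or its complement is; in the latter case the difference is `m`
-- and the colors are 0 and `m`.
circDist≡1⇒next : ∀ {m} (i j : Fin (suc m)) → circDist i j ≡ 1 → j ≡ next i ⊎ i ≡ next j
circDist≡1⇒next {m} i j eq with ℕ.⊓-sel ∣ toℕ i - toℕ j ∣ (suc m ∸ ∣ toℕ i - toℕ j ∣)
... | inj₁ ⊓≡ˡ = Sum.map (next-of-suc i j) (next-of-suc j i)
                   (∣m-n∣≡1⇒consecutive (toℕ i) (toℕ j) (trans (sym ⊓≡ˡ) eq))
... | inj₂ ⊓≡ʳ = Sum.swap (Sum.map (λ (i≡0 , j≡m) → next-of-last j i j≡m i≡0)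
                                   (λ (i≡m , j≡0) → next-of-last i j i≡m j≡0)
                   (∣m-n∣≡o⇒extremal i≤m j≤m d≡m))
  where
  i≤m = Fin.toℕ≤pred[n] i
  j≤m = Fin.toℕ≤pred[n] j
  d≤m = ℕ.≤-trans (ℕ.∣m-n∣≤m⊔n (toℕ i) (toℕ j)) (ℕ.⊔-lub i≤m j≤m)
  d≡m : ∣ toℕ i - toℕ j ∣ ≡ m
  d≡m = ℕ.≤-antisym d≤m (ℕ.m∸n≡0⇒m≤n (ℕ.suc-injective
          (trans (sym (ℕ.+-∸-assoc 1 d≤m)) (trans (sym ⊓≡ʳ) eq))))

-- Colorings of complete graphs, and the identity coloring.

defect-≤ : ∀ {k t n} (f : Fin n → Fin k) u (g : ∀ {v} → circDist (f u) (f v) ≡ 1 → Fin t) →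
           (∀ {v w} (d : circDist (f u) (f v) ≡ 1) (e : circDist (f u) (f w) ≡ 1) → g d ≡ g e → v ≡ w) →
           defect (K n) f u ≤ t
defect-≤ {n = n} f u g g-inj =
  count-≤ (λ v → Graph.adj? (K n) u v ×-dec (circDist (f u) (f v) ℕ.≟ 1)) (g ∘ proj₂)
    (λ (_ , d) (_ , e) → g-inj d e)

coloring-injective : ∀ {k t n} {f : Fin n → Fin k} → IsColoring k t (K n) f → Injective _≡_ _≡_ f
coloring-injective (proper , _) {u} {v} fu≡fv =
  decidable-stable (u Fin.≟ v) λ u≢v → proper u v u≢v fu≡fv

id-coloring : ∀ {t} n → t ≥ 2 → IsColoring n t (K n) id
id-coloring     zero    _   = (λ ()) , λ ()
id-coloring {t} (suc m) t≥2 = (λ _ _ u≢v → u≢v) , λ u → ℕ.≤-trans (defect≤2 u) t≥2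
  where
  -- The two values of `Fin 2` tell the successor of `u` from its predecessor; each side holds a
  -- single color.
  side : ∀ {u v : Fin (suc m)} → v ≡ next u ⊎ u ≡ next v → Fin 2
  side = [ (λ _ → zero) , (λ _ → suc zero) ]′

  side-injective : ∀ {u v w : Fin (suc m)} (p : v ≡ next u ⊎ u ≡ next v) (q : w ≡ next u ⊎ u ≡ next w) →
                   side p ≡ side q → v ≡ w
  side-injective (inj₁ a) (inj₁ b) _ = trans a (sym b)
  side-injective (inj₂ a) (inj₂ b) _ = next-injective (trans (sym a) b)

  defect≤2 : ∀ u → defect (K (suc m)) id u ≤ 2
  defect≤2 u = defect-≤ id u (side ∘ circDist≡1⇒next u _) λ d e →
    side-injective (circDist≡1⇒next u _ d) (circDist≡1⇒next u _ e)

-- The extremal coloring for t = 1: vertex v gets color v + ⌊v/2⌋.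

palette : ℕ → ℕ
palette 0             = 0
palette 1             = 1
palette (suc (suc v)) = 3 + palette v

-- The involution exchanging 2i and 2i + 1, the two vertices whose colors form an isolated pair.
partner : ℕ → ℕ
partner 0             = 1
partner 1             = 0
partner (suc (suc v)) = 2 + partner v

palette-injective : Injective _≡_ _≡_ palette
palette-injective {0}           {0}           _  = refl
palette-injective {0}           {1}           ()
palette-injective {0}           {suc (suc _)} ()
palette-injective {1}           {1}           _  = refl
palette-injective {1}           {suc (suc _)} ()
palette-injective {suc (suc _)} {1}           ()
palette-injective {suc (suc u)} {suc (suc v)} eq = cong (2 +_) (palette-injective (ℕ.+-cancelˡ-≡ 3 _ _ eq))

-- Colors of different pairs differ by at least 2, because a color is skipped after each pair.
palette-close : ∀ u v → ∣ palette u - palette v ∣ ≡ 1 → v ≡ partner u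
palette-close 0             1             _  = refl
palette-close 1             0             _  = refl
palette-close 1             1             ()
palette-close 1             (suc (suc _)) ()
palette-close (suc (suc u)) (suc (suc v)) eq = cong (2 +_) (palette-close u v eq)

-- The 2 keeps the last color free, so that no cyclic distance 1 arises by wrapping around.
palette-bound-even : ∀ p {v} → v < p * 2 → 2 + palette v ≤ p * 3
palette-bound-even (suc p) {0}           _                = s≤s (s≤s z≤n)
palette-bound-even (suc p) {1}           _                = s≤s (s≤s (s≤s z≤n))
palette-bound-even (suc p) {suc (suc v)} (s≤s (s≤s v<2p)) = ℕ.+-monoʳ-≤ 3 (palette-bound-even p v<2p)

-- The unpaired last vertex `p * 2` has color `p * 3`, so among `2 + p * 3` colors again the last
-- one stays free.
palette-bound-odd : ∀ p {v} → v < 1 + p * 2 → 2 + palette v ≤ 2 + p * 3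
palette-bound-odd _       {0}           _                = s≤s (s≤s z≤n)
palette-bound-odd zero    {suc _}       (s≤s ())
palette-bound-odd (suc p) {1}           _                = s≤s (s≤s (s≤s z≤n))
palette-bound-odd (suc p) {suc (suc v)} (s≤s (s≤s v<2p)) = ℕ.+-monoʳ-≤ 3 (palette-bound-odd p v<2p)

palette-colorable : ∀ {n k} → (∀ {v} → v < n → 2 + palette v ≤ k) → Colorable k 1 (K n)
palette-colorable {n} {k} bound = f , proper , λ u →
  -- For the constant map to `Fin 1`, injectivity means that any two close vertices coincide: both
  -- are the partner of `u`.
  defect-≤ f u (λ _ → zero) (λ d e _ → Fin.toℕ-injective (trans (close u _ d) (sym (close u _ e))))
  where
  f : Fin n → Fin k
  f v = fromℕ< (ℕ.<⇒≤ (bound (Fin.toℕ<n v)))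

  toℕ-f : ∀ v → toℕ (f v) ≡ palette (toℕ v)
  toℕ-f v = Fin.toℕ-fromℕ< (ℕ.<⇒≤ (bound (Fin.toℕ<n v)))

  f-bound : ∀ v → 2 + toℕ (f v) ≤ k
  f-bound v = subst (λ c → 2 + c ≤ k) (sym (toℕ-f v)) (bound (Fin.toℕ<n v))

  proper : ∀ u v → u ≢ v → f u ≢ f v
  proper u v u≢v eq = u≢v (Fin.toℕ-injective (palette-injective
    (trans (sym (toℕ-f u)) (trans (cong toℕ eq) (toℕ-f v)))))

  close : ∀ u v → circDist (f u) (f v) ≡ 1 → toℕ v ≡ partner (toℕ u)
  close u v d = palette-close (toℕ u) (toℕ v)
    (subst (_≡ 1) (cong₂ ∣_-_∣ (toℕ-f u) (toℕ-f v))
      (circDist≡1⇒∣-∣≡1 (f u) (f v) (f-bound u) (f-bound v) d))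

-- The lower bound for t = 1.

module _ {m n} (2≤m : 2 ≤ m) {f : Fin n → Fin (suc m)} (col : IsColoring (suc m) 1 (K n) f) where

  Unused : Fin (suc m) → Set
  Unused c = ∀ u → f u ≢ c

  -- If both were used, their two vertices would be distinct, since `2 ≤ m` separates successor from
  -- predecessor, and `u` would have defect at least 2.
  unused-neighbour : ∀ u → Unused (next (f u)) ⊎ Unused (prev (f u))
  unused-neighbour u with Fin.any? (λ v → f v Fin.≟ next (f u)) | Fin.any? (λ w → f w Fin.≟ prev (f u))
  ... | no ¬used       | _              = inj₁ λ v eq → ¬used (v , eq)
  ... | yes _          | no ¬used       = inj₂ λ v eq → ¬used (v , eq)
  ... | yes (v , fv≡n) | yes (w , fw≡p) =
    contradiction (proj₂ col u) (ℕ.<⇒≱ (count-≥2 _ v≢w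
      (adjacent fv≡n (circDist-next 1≤m (f u))) (adjacent fw≡p (circDist-prev 1≤m (f u)))))
    where
    1≤m = ℕ.<⇒≤ 2≤m

    v≢w : v ≢ w
    v≢w v≡w = next≢prev 2≤m (f u) (trans (sym fv≡n) (trans (cong f v≡w) fw≡p))

    adjacent : ∀ {v c} → f v ≡ c → circDist (f u) c ≡ 1 → u ≢ v × circDist (f u) (f v) ≡ 1
    adjacent {v} refl d = u≢v , d
      where
      u≢v : u ≢ v
      u≢v refl = contradiction (trans (sym (circDist-self (f u))) d) λ ()

  place : Fin 3 × Fin n → Fin 2 × Fin (suc m)
  place (zero        , u) = zero , f u
  place (suc zero    , u) = suc zero , f u
  place (suc (suc _) , u) =
    [ (λ _ → zero , next (f u)) , (λ _ → suc zero , prev (f u)) ]′ (unused-neighbour u)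

  place-injective : Injective _≡_ _≡_ place
  place-injective {x} {y} = go x y
    where
    f-injective : Injective _≡_ _≡_ f
    f-injective = coloring-injective col

    go : ∀ x y → place x ≡ place y → x ≡ y
    go (zero , u) (zero , v) eq = cong (_ ,_) (f-injective (proj₂ (,-injective eq)))
    go (suc zero , u) (suc zero , v) eq = cong (_ ,_) (f-injective (proj₂ (,-injective eq)))
    -- Third claims in the same direction reduce to injectivity of a cyclic shift; those in opposite
    -- directions lie in different copies.
    go (suc (suc zero) , u) (suc (suc zero) , v) eq with unused-neighbour u | unused-neighbour v | eq
    ... | inj₁ _ | inj₁ _ | eq = cong (_ ,_) (f-injective (next-injective (proj₂ (,-injective eq))))
    ... | inj₂ _ | inj₂ _ | eq = cong (_ ,_) (f-injective (prev-injective (proj₂ (,-injective eq))))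
    ... | inj₁ _ | inj₂ _ | ()
    ... | inj₂ _ | inj₁ _ | ()
    go (zero , u) (suc (suc zero) , v) eq with unused-neighbour v | eq
    ... | inj₁ unused | eq = contradiction (proj₂ (,-injective eq)) (unused u)
    ... | inj₂ _      | ()
    go (suc zero , u) (suc (suc zero) , v) eq with unused-neighbour v | eq
    ... | inj₂ unused | eq = contradiction (proj₂ (,-injective eq)) (unused u)
    ... | inj₁ _      | ()
    go (suc (suc zero) , u) (zero , v) eq with unused-neighbour u | eq
    ... | inj₁ unused | eq = contradiction (sym (proj₂ (,-injective eq))) (unused v)
    ... | inj₂ _      | ()
    go (suc (suc zero) , u) (suc zero , v) eq with unused-neighbour u | eq
    ... | inj₂ unused | eq = contradiction (sym (proj₂ (,-injective eq))) (unused v)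
    ... | inj₁ _      | ()

  -- Pigeonhole for `place`, with pairs coded as elements of `Fin (3 * n)` and `Fin (2 * suc m)`.
  places-≤ : 3 * n ≤ 2 * suc m
  places-≤ = Fin.injective⇒≤ {f = uncurry combine ∘ place ∘ remQuot {3} n}
    λ {x} {y} eq → remQuot-injective (place-injective (combine-injective eq))
    where
    combine-injective : Injective _≡_ _≡_ (uncurry (combine {2} {suc m}))
    combine-injective {i , j} {i′ , j′} eq = uncurry (cong₂ _,_) (Fin.combine-injective i j i′ j′ eq)

    remQuot-injective : Injective _≡_ _≡_ (remQuot {3} n)
    remQuot-injective {x} {y} eq = trans (sym (Fin.combine-remQuot {3} n x))
      (trans (cong (uncurry combine) eq) (Fin.combine-remQuot {3} n y))

-- Lower bounds for arbitrary k, and the values of the chromatic number.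

colorable⇒n≤k : ∀ {k t n} → Colorable k t (K n) → n ≤ k
colorable⇒n≤k (_ , col) = Fin.injective⇒≤ (coloring-injective col)

-- Three vertices force at least three colors, so that the two cyclic neighbours of a color are
-- distinct. The bound fails for two vertices, where two colors suffice.
colorable⇒3n≤2k : ∀ {k n} → n ≥ 3 → Colorable k 1 (K n) → 3 * n ≤ 2 * k
colorable⇒3n≤2k {k} n≥3 c@(f , col) with k | ℕ.≤-trans n≥3 (colorable⇒n≤k c) | f | col
... | suc m | s≤s 2≤m | _ | col = places-≤ 2≤m col

minimal⇒IsCχ₂ : ∀ {t n k} → n ≥ 1 → Colorable k t (K n) → (∀ l → Colorable l t (K n) → k ≤ l) →
                IsCχ₂ t (K n) k
minimal⇒IsCχ₂ n≥1 c least = ℕ.≤-trans n≥1 (colorable⇒n≤k c) , c , λ l _ → least l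

theorem2p3 : ∀ (t n : ℕ) → t ≥ 1 → n ≥ 1 →
    (t ≡ 1 → n ≥ 3 → 2 ∣ n → IsCχ₂ t (K n) ((3 * n) / 2))
    × (t ≡ 1 → n ≥ 3 → 2 ∤ n → IsCχ₂ t (K n) ((3 * n + 1) / 2))
    × (t ≥ 2 → IsCχ₂ t (K n) n)
theorem2p3 t n _ n≥1 =
  even , odd , λ t≥2 → minimal⇒IsCχ₂ n≥1 (id , id-coloring n t≥2) (λ _ → colorable⇒n≤k)
  where
  even : t ≡ 1 → n ≥ 3 → 2 ∣ n → IsCχ₂ t (K n) ((3 * n) / 2)
  even refl n≥3 (divides-refl p) = subst (IsCχ₂ 1 (K n)) (sym 3n/2≡3p)
    (minimal⇒IsCχ₂ n≥1 (palette-colorable (palette-bound-even p)) λ k c →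
      ℕ.*-cancelˡ-≤ 2 (subst (_≤ 2 * k) (3[2p]≡2[3p] p) (colorable⇒3n≤2k n≥3 c)))
    where
    3[2p]≡2[3p] : ∀ p → 3 * (p * 2) ≡ 2 * (p * 3)
    3[2p]≡2[3p] = solve-∀

    3n/2≡3p : 3 * (p * 2) / 2 ≡ p * 3
    3n/2≡3p = trans (cong (_/ 2) (trans (3[2p]≡2[3p] p) (ℕ.*-comm 2 (p * 3)))) (m*n/n≡m (p * 3) 2)

  odd : t ≡ 1 → n ≥ 3 → 2 ∤ n → IsCχ₂ t (K n) ((3 * n + 1) / 2)
  odd refl n≥3 2∤n with odd-form n 2∤n
  ... | p , refl = subst (IsCχ₂ 1 (K n)) (sym [3n+1]/2≡2+3p)
    (minimal⇒IsCχ₂ n≥1 (palette-colorable (palette-bound-odd p)) λ k c →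
      -- Since `3 * n` is odd, the bound reads `2 * (1 + p * 3) < 2 * k`; cancelling 2 strictly
      -- gives `2 + p * 3 ≤ k`, the rounding up.
      ℕ.*-cancelˡ-< 2 (1 + p * 3) k (subst (_≤ 2 * k) (3n≡1+2[1+3p] p) (colorable⇒3n≤2k n≥3 c)))
    where
    3n≡1+2[1+3p] : ∀ p → 3 * (1 + p * 2) ≡ 1 + 2 * (1 + p * 3)
    3n≡1+2[1+3p] = solve-∀

    3n+1≡[2+3p]2 : ∀ p → 3 * (1 + p * 2) + 1 ≡ (2 + p * 3) * 2
    3n+1≡[2+3p]2 = solve-∀

    [3n+1]/2≡2+3p : (3 * (1 + p * 2) + 1) / 2 ≡ 2 + p * 3
    [3n+1]/2≡2+3p = trans (cong (_/ 2) (3n+1≡[2+3p]2 p)) (m*n/n≡m (2 + p * 3) 2)
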